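{- Let $a,b$ be positive integers and let $\{F_n(q)\}_{n\geq 0}$ be the $q$-biperiodic Fibonacci sequence. For every integer $n\geq 0$, $$F_n(q)=a^{\xi(n-1)}\sum_{l=0}^{\left\lfloor\frac{n-1}{2}\right\rfloor}{n-l-1 \brack l}(ab)^{\left\lfloor\frac{n-1}{2}\right\rfloor-l}q^{l^2}.$$
   Context: Fix positive integers $a,b$; $q$ is an indeterminate. The $q$-biperiodic Fibonacci sequence is defined by $F_0(q)=0$, $F_1(q)=1$ and, for $n\geq 2$, $F_n(q)=aF_{n-1}(q)+q^{n-2}F_{n-2}(q)$ if $n$ is even, $F_n(q)=bF_{n-1}(q)+q^{n-2}F_{n-2}(q)$ if $n$ is odd. For an integer $n$, $\xi(n)=n-2\lfloor n/2\rfloor$ (so $\xi(n)=0$ if $n$ is even and $1$ if $n$ is odd). The $q$-binomial coefficient is ${n\brack k}=\frac{[n]_q!}{[k]_q!\,[n-k]_q!}$ for $0\leq k\leq n$ (and $0$ for $k<0$ or $k>n\ge 0$), where $[n]_q=1+q+\cdots+q^{n-1}$ and $[n]_q!=[1]_q[2]_q\cdots[n]_q$, $[0]_q!=1$. Empty sums are $0$. -}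

module Defs where

open import Data.Bool.Base using (if_then_else_)
open import Data.Empty using (⊥-elim)
open import Data.Integer.Base as ℤ using (ℤ; +_; -[1+_]; 0ℤ; 1ℤ)
open import Data.Integer.DivMod using (_/ℕ_; _%ℕ_; a≡a%ℕn+[a/ℕn]*n)
import Data.Integer.Properties as ℤₚ
open import Data.List.Base using (List; []; _∷_; _++_; map; replicate)
open import Data.Nat.Base as ℕ using (ℕ; zero; suc)
open import Data.Nat.Divisibility using (_∣?_)
open import Data.Nat.Induction using (<-rec)
import Data.Nat.Properties as ℕₚ
open import Data.Sum.Base using (_⊎_; inj₁; inj₂; [_,_]′)
open import Relation.Binary.PropositionalEquality
open import Relation.Nullary using (¬_; does; yes; no)

-- ℤ[q]: coefficient lists, constant term first, considered up to _≈_
-- (so trailing zeros are allowed).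

Poly : Set
Poly = List ℤ

coeff : Poly → ℕ → ℤ
coeff []      _       = 0ℤ
coeff (c ∷ _) zero    = c
coeff (_ ∷ p) (suc i) = coeff p i

infix  4 _≈_
infixl 6 _⊕_
infixl 7 _⊗_
infix  8 q^_

_≈_ : Poly → Poly → Set
p ≈ r = ∀ i → coeff p i ≡ coeff r i

const : ℤ → Poly
const c = c ∷ []

q^_ : ℕ → Poly
q^ k = replicate k 0ℤ ++ 1ℤ ∷ []

_⊕_ : Poly → Poly → Poly
[]      ⊕ r       = r
(c ∷ p) ⊕ []      = c ∷ p
(c ∷ p) ⊕ (d ∷ r) = (c ℤ.+ d) ∷ (p ⊕ r)

_⊗_ : Poly → Poly → Poly
[]      ⊗ r = []
(c ∷ p) ⊗ r = map (c ℤ.*_) r ⊕ (0ℤ ∷ p ⊗ r)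

coeff-⊕ : ∀ p r i → coeff (p ⊕ r) i ≡ coeff p i ℤ.+ coeff r i
coeff-⊕ []      r       i       = sym (ℤₚ.+-identityˡ (coeff r i))
coeff-⊕ (c ∷ p) []      i       = sym (ℤₚ.+-identityʳ (coeff (c ∷ p) i))
coeff-⊕ (c ∷ p) (d ∷ r) zero    = refl
coeff-⊕ (c ∷ p) (d ∷ r) (suc i) = coeff-⊕ p r i

coeff-map : ∀ c r i → coeff (map (c ℤ.*_) r) i ≡ c ℤ.* coeff r i
coeff-map c []      i       = sym (ℤₚ.*-zeroʳ c)
coeff-map c (d ∷ r) zero    = refl
coeff-map c (d ∷ r) (suc i) = coeff-map c r i

coeff-∷⊗ : ∀ c p r i →
           coeff ((c ∷ p) ⊗ r) i ≡ c ℤ.* coeff r i ℤ.+ coeff (0ℤ ∷ p ⊗ r) i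
coeff-∷⊗ c p r i =
  trans (coeff-⊕ (map (c ℤ.*_) r) (0ℤ ∷ p ⊗ r) i)
        (cong (ℤ._+ coeff (0ℤ ∷ p ⊗ r) i) (coeff-map c r i))

⊗-low-zero : ∀ p r i → (∀ {j} → j ℕ.< i → coeff r j ≡ 0ℤ) →
             ∀ {j} → j ℕ.< i → coeff (p ⊗ r) j ≡ 0ℤ
⊗-low-zero []      r i low j<i = refl
⊗-low-zero (c ∷ p) r i low {j} j<i =
  trans (coeff-∷⊗ c p r j)
        (cong₂ ℤ._+_ (trans (cong (c ℤ.*_) (low j<i)) (ℤₚ.*-zeroʳ c)) (tail j j<i))
  where
  tail : ∀ j → j ℕ.< i → coeff (0ℤ ∷ p ⊗ r) j ≡ 0ℤ
  tail zero    _   = refl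
  tail (suc j) j<i = ⊗-low-zero p r i low (ℕₚ.<-trans (ℕₚ.n<1+n j) j<i)

⊗-zero-divisor : ∀ p r → p ⊗ r ≈ [] → p ≈ [] ⊎ r ≈ []
⊗-zero-divisor []      r pr≈0 = inj₁ λ _ → refl
⊗-zero-divisor (c ∷ p) r pr≈0 with c ℤₚ.≟ 0ℤ
... | yes refl = [ (λ p≈0 → inj₁ λ { zero → refl ; (suc i) → p≈0 i }) , inj₂ ]′
                   (⊗-zero-divisor p r λ i →
                     trans (sym (ℤₚ.+-identityˡ _))
                       (trans (sym (coeff-∷⊗ 0ℤ p r (suc i))) (pr≈0 (suc i))))
... | no c≢0   = inj₂ (<-rec (λ i → coeff r i ≡ 0ℤ) step)
  where
  tail : ∀ i → (∀ {j} → j ℕ.< i → coeff r j ≡ 0ℤ) → coeff (0ℤ ∷ p ⊗ r) i ≡ 0ℤ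
  tail zero    _   = refl
  tail (suc i) low = ⊗-low-zero p r (suc i) low (ℕₚ.n<1+n i)

  step : ∀ i → (∀ {j} → j ℕ.< i → coeff r j ≡ 0ℤ) → coeff r i ≡ 0ℤ
  step i low = [ (λ c≡0 → ⊥-elim (c≢0 c≡0)) , (λ e → e) ]′ (ℤₚ.i*j≡0⇒i≡0∨j≡0 c
    (trans (sym (ℤₚ.+-identityʳ _))
      (trans (cong (ℤ._+_ (c ℤ.* coeff r i)) (sym (tail i low)))
        (trans (sym (coeff-∷⊗ c p r i)) (pr≈0 i)))))

⊗-nonzero : ∀ p r → ¬ p ≈ [] → ¬ r ≈ [] → ¬ p ⊗ r ≈ []
⊗-nonzero p r p≉0 r≉0 pr≈0 = [ p≉0 , r≉0 ]′ (⊗-zero-divisor p r pr≈0)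

-- ℚ(q), the field of fractions of ℤ[q]: fractions up to _≃_, as for ℚᵘ.

record RatFun : Set where
  constructor frac
  field
    num   : Poly
    den   : Poly
    den≉0 : ¬ den ≈ []

open RatFun public

infix  4 _≃_
infixl 6 _+ʳ_
infixl 7 _*ʳ_

_≃_ : RatFun → RatFun → Set
x ≃ y = num x ⊗ den y ≈ num y ⊗ den x

_+ʳ_ : RatFun → RatFun → RatFun
x +ʳ y = frac (num x ⊗ den y ⊕ num y ⊗ den x) (den x ⊗ den y)
              (⊗-nonzero (den x) (den y) (den≉0 x) (den≉0 y))

_*ʳ_ : RatFun → RatFun → RatFun
x *ʳ y = frac (num x ⊗ num y) (den x ⊗ den y)
              (⊗-nonzero (den x) (den y) (den≉0 x) (den≉0 y))

1≉0 : ¬ const 1ℤ ≈ []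
1≉0 e with () ← e 0

ι : Poly → RatFun
ι p = frac p (const 1ℤ) 1≉0

0ʳ : RatFun
0ʳ = ι []

Σ≤ : ℕ → (ℕ → RatFun) → RatFun
Σ≤ zero    f = f zero
Σ≤ (suc m) f = Σ≤ m f +ʳ f (suc m)

Σ₀ : ℤ → (ℕ → RatFun) → RatFun
Σ₀ (+ m)    f = Σ≤ m f
Σ₀ -[1+ _ ] f = 0ʳ

-- 1 + q + ⋯ + qⁿ⁻¹
[_]q : ℕ → Poly
[ n ]q = replicate n 1ℤ

[_]q! : ℕ → Poly
[ zero  ]q! = const 1ℤ
[ suc n ]q! = [ n ]q! ⊗ [ suc n ]q

[]q!-nonzero : ∀ n → ¬ [ n ]q! ≈ []
[]q!-nonzero zero    = 1≉0
[]q!-nonzero (suc n) =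
  ⊗-nonzero [ n ]q! [ suc n ]q ([]q!-nonzero n) (λ e → 1≉0 λ { zero → e 0 ; (suc _) → refl })

qBinom : ℕ → ℕ → RatFun
qBinom n k =
  if does (k ℕₚ.≤? n)
  then frac [ n ]q! ([ k ]q! ⊗ [ n ℕ.∸ k ]q!)
            (⊗-nonzero [ k ]q! [ n ℕ.∸ k ]q! ([]q!-nonzero k) ([]q!-nonzero (n ℕ.∸ k)))
  else 0ʳ

F : ℕ → ℕ → ℕ → Poly
F a b zero          = []
F a b (suc zero)    = const 1ℤ
F a b (suc (suc m)) =
  const (+ (if does (2 ∣? suc (suc m)) then a else b)) ⊗ F a b (suc m) ⊕ q^ m ⊗ F a b m

-- _/ℕ_ rounds towards -∞, so this is the floor for negative n as well.
⌊_/2⌋ : ℤ → ℤ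
⌊ n /2⌋ = n /ℕ 2

ξ : ℤ → ℕ
ξ n = n %ℕ 2

ξ-floor : ∀ n → + ξ n ≡ n ℤ.- + 2 ℤ.* ⌊ n /2⌋
ξ-floor n = sym (begin
  n ℤ.- + 2 ℤ.* ⌊ n /2⌋   ≡⟨ cong (λ t → n ℤ.- t) (ℤₚ.*-comm (+ 2) ⌊ n /2⌋) ⟩
  n ℤ.- h                 ≡⟨ cong (ℤ._- h) (a≡a%ℕn+[a/ℕn]*n n 2) ⟩
  + ξ n ℤ.+ h ℤ.- h       ≡⟨ ℤₚ.+-assoc (+ ξ n) h (ℤ.- h) ⟩
  + ξ n ℤ.+ (h ℤ.- h)     ≡⟨ cong (ℤ._+_ (+ ξ n)) (ℤₚ.+-inverseʳ h) ⟩
  + ξ n ℤ.+ 0ℤ            ≡⟨ ℤₚ.+-identityʳ (+ ξ n) ⟩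
  + ξ n                   ∎)
  where
  open ≡-Reasoning
  h = ⌊ n /2⌋ ℤ.* + 2

{-# OPTIONS --safe #-}
module Submission where

-- Write n - 1 = e + 2h with e ∈ {0, 1} and index the sum by pairs (l , j) with
-- l + j = h, so that the exponent of ab is j and the q-binomial coefficient has
-- bottom l and co-bottom e + 2j. The Pascal rule
-- [m, k] = [m-1, k] + q^(m-k) [m-1, k-1] splits the sum for n into the sum for
-- n - 1 and q^(n-2) times the sum for n - 2, since
-- (n - 1 - 2l) + l² = (n - 2) + (l - 1)².
-- This works over any commutative semiring.

open import Algebra.Bundles using (CommutativeSemiring)
import Algebra.Properties.Semiring.Exp as Exp
import Algebra.Solver.Ring.NaturalCoefficients.Default as SemiringSolver
open import Data.Nat.Base as ℕ using (ℕ; zero; suc; s≤s)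
import Data.Nat.Properties as ℕₚ
import Data.Nat.Solver as ℕSolver
open import Data.Product.Base using (_×_; _,_; proj₁; proj₂)
open import Relation.Binary.Structures using (IsEquivalence)
open import Relation.Binary.PropositionalEquality as ≡ using (_≡_)
import Relation.Binary.Reasoning.Setoid as SetoidReasoning
open import Algebra.Structures.Biased using (isCommutativeSemiringˡ)
open import Data.Bool.Base using (if_then_else_)
open import Data.Integer.Base as ℤ using (0ℤ)
import Data.Integer.Properties as ℤₚ
open import Data.Integer.Tactic.RingSolver using (solve-∀)
open import Data.List.Base using ([]; _∷_; map)
open import Data.Nat.Divisibility using (_∣_; _∣?_; divides; n∣m⇒m%n≡0)
open import Data.Nat.DivMod using (_/_; _%_; m≡m%n+[m/n]*n; m%n<n; [m+kn]%n≡m%n)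
open import Level using (0ℓ)
open import Relation.Nullary using (¬_; does)
open import Relation.Nullary.Decidable using (dec-true; dec-false)

-- Sums over antidiagonals

module DiagonalSum {c ℓ} (R : CommutativeSemiring c ℓ) where

  open CommutativeSemiring R
  open SetoidReasoning setoid
  open SemiringSolver R using (solve; _:=_; _:+_; _:*_)

  -- The sum of f l j over l + j ≡ h.
  diag : ℕ → (ℕ → ℕ → Carrier) → Carrier
  diag zero    f = f 0 0
  diag (suc h) f = diag h (λ l j → f l (suc j)) + f (suc h) 0

  diag-cong : ∀ h {f g} → (∀ l j → l ℕ.+ j ≡ h → f l j ≈ g l j) → diag h f ≈ diag h g
  diag-cong zero    f≈g = f≈g 0 0 ≡.refl
  diag-cong (suc h) f≈g = +-cong
    (diag-cong h λ l j e → f≈g l (suc j) (≡.trans (ℕₚ.+-suc l j) (≡.cong suc e)))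
    (f≈g (suc h) 0 (ℕₚ.+-identityʳ (suc h)))

  diag-+ : ∀ h f g → diag h (λ l j → f l j + g l j) ≈ diag h f + diag h g
  diag-+ zero    f g = refl
  diag-+ (suc h) f g = trans (+-congʳ (diag-+ h _ _))
    (solve 4 (λ u v x y → (u :+ v) :+ (x :+ y) := (u :+ x) :+ (v :+ y)) refl
      (diag h (λ l j → f l (suc j))) (diag h (λ l j → g l (suc j))) (f (suc h) 0) (g (suc h) 0))

  diag-*ˡ : ∀ h x f → diag h (λ l j → x * f l j) ≈ x * diag h f
  diag-*ˡ zero    x f = refl
  diag-*ˡ (suc h) x f = trans (+-congʳ (diag-*ˡ h x _)) (sym (distribˡ x _ _))

  diag-shift : ∀ h f → diag (suc h) f ≈ f 0 (suc h) + diag h (λ l j → f (suc l) j)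
  diag-shift zero    f = refl
  diag-shift (suc h) f = trans (+-congʳ (diag-shift h (λ l j → f l (suc j)))) (+-assoc _ _ _)

  -- Shaped for a Pascal rule: the summand `k` has its bottom index lowered by one, so it lives on
  -- the diagonal `h` and contributes nothing at `l = 0`.
  diag-split : ∀ h f g k →
    f 0 (suc h) ≈ g 0 (suc h) →
    (∀ l j → l ℕ.+ j ≡ h → f (suc l) j ≈ g (suc l) j + k l j) →
    diag (suc h) f ≈ diag (suc h) g + diag h k
  diag-split h f g k f₀ f₊ = begin
    diag (suc h) f                                            ≈⟨ diag-shift h f ⟩
    f 0 (suc h) + diag h (λ l j → f (suc l) j)                ≈⟨ +-cong f₀ (diag-cong h f₊) ⟩
    g 0 (suc h) + diag h (λ l j → g (suc l) j + k l j)        ≈⟨ +-congˡ (diag-+ h _ k) ⟩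
    g 0 (suc h) + (diag h (λ l j → g (suc l) j) + diag h k)   ≈⟨ +-assoc _ _ _ ⟨
    g 0 (suc h) + diag h (λ l j → g (suc l) j) + diag h k     ≈⟨ +-congʳ (diag-shift h g) ⟨
    diag (suc h) g + diag h k                                 ∎

  -- The variant in which the first Pascal summand drops to the diagonal `h` as well, because it
  -- loses one unit of `j`; at `j = 0` it is absent.
  diag-split-suc : ∀ h f g k →
    f 0 (suc h) ≈ g 0 h →
    f (suc h) 0 ≈ k h 0 →
    (∀ l j → l ℕ.+ suc j ≡ h → f (suc l) (suc j) ≈ g (suc l) j + k l (suc j)) →
    diag (suc h) f ≈ diag h g + diag h k
  diag-split-suc h f g k f₀ f∙0 f₊ =
    trans (diag-split h f g′ k f₀ split) (+-congʳ (+-identityʳ (diag h g)))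
    where
    -- Padding `g` with zero at `j = 0` lifts it to the diagonal `suc h`, where `diag-split`
    -- applies.
    g′ : ℕ → ℕ → Carrier
    g′ l zero    = 0#
    g′ l (suc j) = g l j

    split : ∀ l j → l ℕ.+ j ≡ h → f (suc l) j ≈ g′ (suc l) j + k l j
    split l zero    e with ≡.refl ← ≡.trans (≡.sym (ℕₚ.+-identityʳ l)) e =
      trans f∙0 (sym (+-identityˡ _))
    split l (suc j) e = f₊ l j e

-- Gaussian binomials and q-factorials

module GaussianBinomial {c ℓ} (R : CommutativeSemiring c ℓ)
                        (q : CommutativeSemiring.Carrier R) where

  open CommutativeSemiring R
  open Exp semiring using (_^_)
  open SetoidReasoning setoid
  open SemiringSolver R using (solve; con; _:=_; _:+_; _:*_)

  qInt : ℕ → Carrier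
  qInt zero    = 0#
  qInt (suc n) = 1# + q * qInt n

  qFact : ℕ → Carrier
  qFact zero    = 1#
  qFact (suc n) = qFact n * qInt (suc n)

  -- gauss k j is the q-binomial coefficient with top k + j and bottom k.
  gauss : ℕ → ℕ → Carrier
  gauss zero    j       = 1#
  gauss (suc k) zero    = 1#
  gauss (suc k) (suc j) = gauss (suc k) j + q ^ suc j * gauss k (suc j)

  gauss-0ʳ : ∀ k → gauss k 0 ≡ 1#
  gauss-0ʳ zero    = ≡.refl
  gauss-0ʳ (suc k) = ≡.refl

  -- The geometric progression of length `j + k` is cut after its first `j` terms.
  qInt-+ : ∀ j k → qInt (j ℕ.+ k) ≈ qInt j + q ^ j * qInt k
  qInt-+ zero    k = sym (trans (+-identityˡ _) (*-identityˡ _))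
  qInt-+ (suc j) k = trans (+-congˡ (*-congˡ (qInt-+ j k)))
    (solve 4 (λ q J p K → con 1 :+ q :* (J :+ p :* K) := (con 1 :+ q :* J) :+ (q :* p) :* K) refl
      q (qInt j) (q ^ j) (qInt k))

  -- The factorial formula with its denominator cleared, so that it makes sense in a semiring; the
  -- induction follows the Pascal rule.
  qFact-+ : ∀ k j → qFact (k ℕ.+ j) ≈ gauss k j * (qFact k * qFact j)
  qFact-+ zero    j       = sym (trans (*-identityˡ _) (*-identityˡ _))
  qFact-+ (suc k) zero    = begin
    qFact (suc k ℕ.+ 0)              ≡⟨ ≡.cong qFact (ℕₚ.+-identityʳ (suc k)) ⟩
    qFact (suc k)                    ≈⟨ *-identityʳ _ ⟨
    qFact (suc k) * 1#               ≈⟨ *-identityˡ _ ⟨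
    1# * (qFact (suc k) * 1#)        ∎
  qFact-+ (suc k) (suc j) = begin
    N * qInt (suc k ℕ.+ suc j)
      -- With `suc j` in front, the cut produces the Pascal weight `q ^ suc j`.
      ≡⟨ ≡.cong (λ m → N * qInt m) (ℕₚ.+-comm (suc k) (suc j)) ⟩
    N * qInt (suc j ℕ.+ suc k)
      ≈⟨ *-congˡ (qInt-+ (suc j) (suc k)) ⟩
    N * (J + p * K)
      ≈⟨ distribˡ N J (p * K) ⟩
    N * J + N * (p * K)
      -- `N` is read as the factorial of `suc k + j` in one half and of `k + suc j` in the other,
      -- one for each Pascal summand.
      ≈⟨ +-cong (*-congʳ (trans (reflexive (≡.cong qFact (ℕₚ.+-suc k j))) (qFact-+ (suc k) j)))
                (*-congʳ (qFact-+ k (suc j))) ⟩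
    gauss (suc k) j * (qFact k * K * qFact j) * J + gauss k (suc j) * (qFact k * (qFact j * J)) * (p * K)
      ≈⟨ solve 7 (λ g g′ x y J K p →
           g :* (x :* K :* y) :* J :+ g′ :* (x :* (y :* J)) :* (p :* K)
             := (g :+ p :* g′) :* (x :* K :* (y :* J))) refl
           (gauss (suc k) j) (gauss k (suc j)) (qFact k) (qFact j) J K p ⟩
    gauss (suc k) (suc j) * (qFact (suc k) * qFact (suc j))
      ∎
    where
    N = qFact (k ℕ.+ suc j)
    J = qInt (suc j)
    K = qInt (suc k)
    p = q ^ suc j

-- The biperiodic recurrence for the closed form

module BiperiodicFibonacci {c ℓ} (R : CommutativeSemiring c ℓ)
                           (q a b : CommutativeSemiring.Carrier R) where

  open CommutativeSemiring R
  open Exp semiring using (_^_; ^-homo-*)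
  open SetoidReasoning setoid
  open SemiringSolver R using (solve; con; _:=_; _:+_; _:*_)
  open DiagonalSum R
  open GaussianBinomial R q

  term : ℕ → ℕ → ℕ → Carrier
  term e l j = gauss l (e ℕ.+ j ℕ.* 2) * (a * b) ^ j * q ^ (l ℕ.^ 2)

  -- `closed 0 h` will be the Fibonacci value at 2h + 1, and `a * closed 1 h` the one at 2h + 2.
  closed : ℕ → ℕ → Carrier
  closed e h = diag h (term e)

  exponent : ∀ l j → j ℕ.* 2 ℕ.+ suc l ℕ.^ 2 ≡ suc ((l ℕ.+ j) ℕ.* 2) ℕ.+ l ℕ.^ 2
  exponent = ℕS.solve 2 (λ l j →
    j ℕS.:* ℕS.con 2 ℕS.:+ (ℕS.con 1 ℕS.:+ l) ℕS.:^ 2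
      ℕS.:= (ℕS.con 1 ℕS.:+ ((l ℕS.:+ j) ℕS.:* ℕS.con 2)) ℕS.:+ l ℕS.:^ 2) ≡.refl
    where module ℕS = ℕSolver.+-*-Solver

  -- Since (l + 1)² = l² + 2l + 1, the Pascal weight and the square combine into a power of `q` that
  -- depends only on `e` and `l + j`, beside the lower square. That power is constant along a
  -- diagonal and can leave the sum.
  shift-power : ∀ e l j g x →
    q ^ (e ℕ.+ j ℕ.* 2) * g * x * q ^ (suc l ℕ.^ 2)
      ≈ q ^ (e ℕ.+ suc ((l ℕ.+ j) ℕ.* 2)) * (g * x * q ^ (l ℕ.^ 2))
  shift-power e l j g x = begin
    q ^ m * g * x * q ^ s       ≈⟨ regroup (q ^ m) g x (q ^ s) ⟩
    q ^ m * q ^ s * (g * x)     ≈⟨ *-congʳ powers ⟩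
    q ^ M * q ^ t * (g * x)     ≈⟨ regroup′ (q ^ M) g x (q ^ t) ⟩
    q ^ M * (g * x * q ^ t)     ∎
    where
    m = e ℕ.+ j ℕ.* 2
    M = e ℕ.+ suc ((l ℕ.+ j) ℕ.* 2)
    s = suc l ℕ.^ 2
    t = l ℕ.^ 2
    regroup = solve 4 (λ u g x v → u :* g :* x :* v := u :* v :* (g :* x)) refl
    regroup′ = solve 4 (λ u g x v → u :* v :* (g :* x) := u :* (g :* x :* v)) refl

    powers : q ^ m * q ^ s ≈ q ^ M * q ^ t
    powers = begin
      q ^ m * q ^ s                         ≈⟨ ^-homo-* q m s ⟨
      q ^ (m ℕ.+ s)                         ≡⟨ ≡.cong (q ^_) (ℕₚ.+-assoc e (j ℕ.* 2) s) ⟩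
      q ^ (e ℕ.+ (j ℕ.* 2 ℕ.+ s))           ≡⟨ ≡.cong (λ i → q ^ (e ℕ.+ i)) (exponent l j) ⟩
      q ^ (e ℕ.+ (suc ((l ℕ.+ j) ℕ.* 2) ℕ.+ t))
        ≡⟨ ≡.cong (q ^_) (ℕₚ.+-assoc e (suc ((l ℕ.+ j) ℕ.* 2)) t) ⟨
      q ^ (M ℕ.+ t)                         ≈⟨ ^-homo-* q M t ⟩
      q ^ M * q ^ t                         ∎

  -- Lowering the co-bottom 2j + 2 gives 1 + 2j: the first Pascal summand passes from `e = 0` to
  -- `e = 1` with `j` one smaller, which frees a factor `a * b`. At co-bottom zero only the second
  -- summand is present.
  closed-even : ∀ h →
    closed 0 (suc h) ≈ a * b * closed 1 h + q ^ suc (h ℕ.* 2) * closed 0 h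
  closed-even h = begin
    closed 0 (suc h)
      ≈⟨ diag-split-suc h (term 0)
           (λ l j → a * b * term 1 l j)
           (λ l j → q ^ suc (h ℕ.* 2) * term 0 l j) first last middle ⟩
    diag h (λ l j → a * b * term 1 l j) + diag h (λ l j → q ^ suc (h ℕ.* 2) * term 0 l j)
      ≈⟨ +-cong (diag-*ˡ h _ _) (diag-*ˡ h _ _) ⟩
    a * b * closed 1 h + q ^ suc (h ℕ.* 2) * closed 0 h
      ∎
    where
    first : term 0 0 (suc h) ≈ a * b * term 1 0 h
    first = solve 3 (λ c x y → con 1 :* (c :* x) :* y := c :* (con 1 :* x :* y)) refl
              (a * b) ((a * b) ^ h) (q ^ 0)

    last : term 0 (suc h) 0 ≈ q ^ suc (h ℕ.* 2) * term 0 h 0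
    last = begin
      1# * 1# * q ^ (suc h ℕ.^ 2)
        -- The inserted `1#` is `q ^ 0`, the weight that `shift-power` expects at `e = j = 0`.
        ≈⟨ *-congʳ (*-congʳ (*-identityˡ 1#)) ⟨
      1# * 1# * 1# * q ^ (suc h ℕ.^ 2)
        ≈⟨ shift-power 0 h 0 1# 1# ⟩
      q ^ suc ((h ℕ.+ 0) ℕ.* 2) * (1# * 1# * q ^ (h ℕ.^ 2))
        ≡⟨ ≡.cong₂ (λ m g → q ^ suc (m ℕ.* 2) * (g * 1# * q ^ (h ℕ.^ 2)))
             (ℕₚ.+-identityʳ h) (≡.sym (gauss-0ʳ h)) ⟩
      q ^ suc (h ℕ.* 2) * term 0 h 0
        ∎

    middle : ∀ l j → l ℕ.+ suc j ≡ h →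
      term 0 (suc l) (suc j) ≈ a * b * term 1 (suc l) j + q ^ suc (h ℕ.* 2) * term 0 l (suc j)
    middle l j ≡.refl = trans
      (solve 6 (λ g p g′ c x y → (g :+ p :* g′) :* (c :* x) :* y
                  := c :* (g :* x :* y) :+ p :* g′ :* (c :* x) :* y) refl
         (gauss (suc l) (suc (j ℕ.* 2))) (q ^ (suc j ℕ.* 2)) (gauss l (suc j ℕ.* 2))
         (a * b) ((a * b) ^ j) (q ^ (suc l ℕ.^ 2)))
      (+-congˡ (shift-power 0 l (suc j) _ _))

  -- Lowering the co-bottom 1 + 2j only changes `e` from 1 to 0. Since `j` stays, no factor `a * b`
  -- appears and the first sum remains on the diagonal `suc h`.
  closed-odd : ∀ h →
    closed 1 (suc h) ≈ closed 0 (suc h) + q ^ suc (suc (h ℕ.* 2)) * closed 1 h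
  closed-odd h = begin
    closed 1 (suc h)
      ≈⟨ diag-split h (term 1) (term 0) (λ l j → q ^ suc (suc (h ℕ.* 2)) * term 1 l j) refl step ⟩
    closed 0 (suc h) + diag h (λ l j → q ^ suc (suc (h ℕ.* 2)) * term 1 l j)
      ≈⟨ +-congˡ (diag-*ˡ h _ _) ⟩
    closed 0 (suc h) + q ^ suc (suc (h ℕ.* 2)) * closed 1 h
      ∎
    where
    step : ∀ l j → l ℕ.+ j ≡ h →
      term 1 (suc l) j ≈ term 0 (suc l) j + q ^ suc (suc (h ℕ.* 2)) * term 1 l j
    step l j ≡.refl = trans
      (solve 5 (λ g p g′ x y → (g :+ p :* g′) :* x :* y
                  := g :* x :* y :+ p :* g′ :* x :* y) refl
         (gauss (suc l) (j ℕ.* 2)) (q ^ suc (j ℕ.* 2)) (gauss l (suc (j ℕ.* 2)))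
         ((a * b) ^ j) (q ^ (suc l ℕ.^ 2)))
      (+-congˡ (shift-power 1 l j _ _))

  module _ (f : ℕ → Carrier) (f₀ : f 0 ≈ 0#) (f₁ : f 1 ≈ 1#)
    (f-even : ∀ h → f (suc h ℕ.* 2) ≈ a * f (suc (h ℕ.* 2)) + q ^ (h ℕ.* 2) * f (h ℕ.* 2))
    (f-odd  : ∀ h → f (suc (suc h ℕ.* 2)) ≈
                    b * f (suc h ℕ.* 2) + q ^ suc (h ℕ.* 2) * f (suc (h ℕ.* 2)))
    where

    -- Two consecutive values are carried through the induction because the recurrence has order
    -- two.
    f-closed : ∀ h → f (suc (h ℕ.* 2)) ≈ closed 0 h × f (suc h ℕ.* 2) ≈ a * closed 1 h
    f-closed zero = f1 , (begin
      f 2                        ≈⟨ f-even 0 ⟩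
      a * f 1 + q ^ 0 * f 0      ≈⟨ +-cong (*-congˡ f1) (*-congˡ f₀) ⟩
      a * closed 0 0 + 1# * 0#   ≈⟨ +-congˡ (zeroʳ 1#) ⟩
      a * closed 0 0 + 0#        ≈⟨ +-identityʳ _ ⟩
      a * closed 0 0             ∎)
      where
      f1 : f 1 ≈ closed 0 0
      f1 = trans f₁ (sym (trans (*-identityʳ _) (*-identityʳ _)))
    f-closed (suc h) = odd , (begin
      f (suc (suc h) ℕ.* 2)
        ≈⟨ f-even (suc h) ⟩
      a * f (suc (suc h ℕ.* 2)) + p * f (suc h ℕ.* 2)
        ≈⟨ +-cong (*-congˡ odd) (*-congˡ (proj₂ (f-closed h))) ⟩
      a * closed 0 (suc h) + p * (a * closed 1 h)
        ≈⟨ solve 4 (λ a x p y → a :* x :+ p :* (a :* y) := a :* (x :+ p :* y)) refl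
             a (closed 0 (suc h)) p (closed 1 h) ⟩
      a * (closed 0 (suc h) + p * closed 1 h)
        ≈⟨ *-congˡ (closed-odd h) ⟨
      a * closed 1 (suc h)
        ∎)
      where
      p = q ^ (suc h ℕ.* 2)

      odd : f (suc (suc h ℕ.* 2)) ≈ closed 0 (suc h)
      odd = begin
        f (suc (suc h ℕ.* 2))
          ≈⟨ f-odd h ⟩
        b * f (suc h ℕ.* 2) + q ^ suc (h ℕ.* 2) * f (suc (h ℕ.* 2))
          ≈⟨ +-cong (*-congˡ (proj₂ (f-closed h))) (*-congˡ (proj₁ (f-closed h))) ⟩
        b * (a * closed 1 h) + q ^ suc (h ℕ.* 2) * closed 0 h
          ≈⟨ +-congʳ (solve 3 (λ a b x → b :* (a :* x) := a :* b :* x) refl a b (closed 1 h)) ⟩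
        a * b * closed 1 h + q ^ suc (h ℕ.* 2) * closed 0 h
          ≈⟨ closed-even h ⟨
        closed 0 (suc h)
          ∎

    f-expansion : ∀ e h → e ℕ.< 2 → f (suc (e ℕ.+ h ℕ.* 2)) ≈ a ^ e * closed e h
    f-expansion 0 h _ = trans (proj₁ (f-closed h)) (sym (*-identityˡ _))
    f-expansion 1 h _ = trans (proj₂ (f-closed h)) (*-congʳ (sym (*-identityʳ a)))
    f-expansion (suc (suc _)) h (s≤s (s≤s ()))

open import Defs
open import Data.Nat.Base using (ℕ; NonZero; _^_; _∸_; _*_)
open import Data.Integer.Base using (+_; _-_; ∣_∣; 1ℤ)


open ≡ using (cong; cong₂)

-- The commutative semiring of integer polynomials

∷-cong : ∀ c p r → p ≈ r → c ∷ p ≈ c ∷ r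
∷-cong c p r p≈r zero    = ≡.refl
∷-cong c p r p≈r (suc i) = p≈r i

coeff-0∷[] : ∀ i → coeff (0ℤ ∷ []) i ≡ 0ℤ
coeff-0∷[] zero    = ≡.refl
coeff-0∷[] (suc i) = ≡.refl

coeff-0∷map : ∀ c p i → coeff (0ℤ ∷ map (c ℤ.*_) p) i ≡ c ℤ.* coeff (0ℤ ∷ p) i
coeff-0∷map c p zero    = ≡.sym (ℤₚ.*-zeroʳ c)
coeff-0∷map c p (suc i) = coeff-map c p i

⊗-[] : ∀ p → p ⊗ [] ≈ []
⊗-[] []      i       = ≡.refl
⊗-[] (c ∷ p) zero    = ≡.refl
⊗-[] (c ∷ p) (suc i) = ⊗-[] p i

-- Mirrors the defining recursion of `_⊗_` on the right factor; commutativity then follows by a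
-- direct induction.
⊗-∷ : ∀ p c r → p ⊗ (c ∷ r) ≈ map (c ℤ.*_) p ⊕ (0ℤ ∷ p ⊗ r)
⊗-∷ []      c r i       = ≡.sym (coeff-0∷[] i)
⊗-∷ (d ∷ p) c r zero    = cong (ℤ._+ 0ℤ) (ℤₚ.*-comm d c)
⊗-∷ (d ∷ p) c r (suc i)
  rewrite coeff-⊕ (map (d ℤ.*_) r) (p ⊗ (c ∷ r)) i
        | ⊗-∷ p c r i
        | coeff-⊕ (map (c ℤ.*_) p) (0ℤ ∷ p ⊗ r) i
        | coeff-⊕ (map (c ℤ.*_) p) (map (d ℤ.*_) r ⊕ (0ℤ ∷ p ⊗ r)) i
        | coeff-⊕ (map (d ℤ.*_) r) (0ℤ ∷ p ⊗ r) i
  = swap (coeff (map (d ℤ.*_) r) i) (coeff (map (c ℤ.*_) p) i) (coeff (0ℤ ∷ p ⊗ r) i)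
  where
  swap : ∀ x y z → x ℤ.+ (y ℤ.+ z) ≡ y ℤ.+ (x ℤ.+ z)
  swap = solve-∀

⊗-comm : ∀ p r → p ⊗ r ≈ r ⊗ p
⊗-comm []      r i = ≡.sym (⊗-[] r i)
⊗-comm (c ∷ p) r i
  rewrite ⊗-∷ r c p i
        | coeff-⊕ (map (c ℤ.*_) r) (0ℤ ∷ p ⊗ r) i
        | coeff-⊕ (map (c ℤ.*_) r) (0ℤ ∷ r ⊗ p) i
        | ∷-cong 0ℤ (p ⊗ r) (r ⊗ p) (⊗-comm p r) i
  = ≡.refl

⊗-congˡ : ∀ p r s → r ≈ s → p ⊗ r ≈ p ⊗ s
⊗-congˡ []      r s r≈s i = ≡.refl
⊗-congˡ (c ∷ p) r s r≈s i
  rewrite coeff-∷⊗ c p r i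
        | coeff-∷⊗ c p s i
        | r≈s i
        | ∷-cong 0ℤ (p ⊗ r) (p ⊗ s) (⊗-congˡ p r s r≈s) i
  = ≡.refl

⊗-distribʳ-⊕ : ∀ s p r → (p ⊕ r) ⊗ s ≈ p ⊗ s ⊕ r ⊗ s
⊗-distribʳ-⊕ s []      r       i = ≡.refl
⊗-distribʳ-⊕ s (c ∷ p) []      i =
  ≡.sym (≡.trans (coeff-⊕ ((c ∷ p) ⊗ s) [] i) (ℤₚ.+-identityʳ _))
⊗-distribʳ-⊕ s (c ∷ p) (d ∷ r) i
  rewrite coeff-∷⊗ (c ℤ.+ d) (p ⊕ r) s i
        | coeff-⊕ ((c ∷ p) ⊗ s) ((d ∷ r) ⊗ s) i
        | coeff-∷⊗ c p s i
        | coeff-∷⊗ d r s i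
        | ∷-cong 0ℤ ((p ⊕ r) ⊗ s) (p ⊗ s ⊕ r ⊗ s) (⊗-distribʳ-⊕ s p r) i
        | coeff-⊕ (0ℤ ∷ p ⊗ s) (0ℤ ∷ r ⊗ s) i
  = regroup c d (coeff s i) (coeff (0ℤ ∷ p ⊗ s) i) (coeff (0ℤ ∷ r ⊗ s) i)
  where
  regroup : ∀ c d s x y →
            (c ℤ.+ d) ℤ.* s ℤ.+ (x ℤ.+ y) ≡ c ℤ.* s ℤ.+ x ℤ.+ (d ℤ.* s ℤ.+ y)
  regroup = solve-∀

0∷-⊗ : ∀ p r → (0ℤ ∷ p) ⊗ r ≈ 0ℤ ∷ p ⊗ r
0∷-⊗ p r i = ≡.trans (coeff-∷⊗ 0ℤ p r i) (ℤₚ.+-identityˡ _)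

map-⊗ : ∀ c p r → map (c ℤ.*_) p ⊗ r ≈ map (c ℤ.*_) (p ⊗ r)
map-⊗ c []      r i = ≡.refl
map-⊗ c (d ∷ p) r i
  rewrite coeff-∷⊗ (c ℤ.* d) (map (c ℤ.*_) p) r i
        | ∷-cong 0ℤ (map (c ℤ.*_) p ⊗ r) (map (c ℤ.*_) (p ⊗ r)) (map-⊗ c p r) i
        | coeff-0∷map c (p ⊗ r) i
        | coeff-map c ((d ∷ p) ⊗ r) i
        | coeff-∷⊗ d p r i
  = factor c d (coeff r i) (coeff (0ℤ ∷ p ⊗ r) i)
  where
  factor : ∀ c d r x → c ℤ.* d ℤ.* r ℤ.+ c ℤ.* x ≡ c ℤ.* (d ℤ.* r ℤ.+ x)
  factor = solve-∀

⊗-assoc : ∀ p r s → (p ⊗ r) ⊗ s ≈ p ⊗ (r ⊗ s)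
⊗-assoc []      r s i = ≡.refl
⊗-assoc (c ∷ p) r s i
  rewrite ⊗-distribʳ-⊕ s (map (c ℤ.*_) r) (0ℤ ∷ p ⊗ r) i
        | coeff-⊕ (map (c ℤ.*_) r ⊗ s) ((0ℤ ∷ p ⊗ r) ⊗ s) i
        | coeff-⊕ (map (c ℤ.*_) (r ⊗ s)) (0ℤ ∷ p ⊗ (r ⊗ s)) i
        | map-⊗ c r s i
        | 0∷-⊗ (p ⊗ r) s i
        | ∷-cong 0ℤ ((p ⊗ r) ⊗ s) (p ⊗ (r ⊗ s)) (⊗-assoc p r s) i
  = ≡.refl

⊗-identityˡ : ∀ p → const 1ℤ ⊗ p ≈ p
⊗-identityˡ p i
  rewrite coeff-∷⊗ 1ℤ [] p i | coeff-0∷[] i = simplify (coeff p i)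
  where
  simplify : ∀ x → 1ℤ ℤ.* x ℤ.+ 0ℤ ≡ x
  simplify = solve-∀

infix 4 _≋_

-- A record, unlike the function type _≈_, lets Agda infer the two polynomials.
record _≋_ (p r : Poly) : Set where
  constructor coeffwise
  field
    at : p ≈ r

open _≋_

polySemiring : CommutativeSemiring 0ℓ 0ℓ
polySemiring = record
  { Carrier = Poly
  ; _≈_     = _≋_
  ; _+_     = _⊕_
  ; _*_     = _⊗_
  ; 0#      = []
  ; 1#      = const 1ℤ
  ; isCommutativeSemiring = isCommutativeSemiringˡ record
    { +-isCommutativeMonoid = record
      { isMonoid = record
        { isSemigroup = record
          { isMagma = record
            { isEquivalence = ≋-isEquivalence
            ; ∙-cong        = λ {p} {r} {s} {t} → ⊕-cong p r s t
            }
          ; assoc   = ⊕-assoc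
          }
        ; identity = (λ p → ≋-refl) , (λ p → coeffwise λ i →
            ≡.trans (coeff-⊕ p [] i) (ℤₚ.+-identityʳ _))
        }
      ; comm = ⊕-comm
      }
    ; *-isCommutativeMonoid = record
      { isMonoid = record
        { isSemigroup = record
          { isMagma = record
            { isEquivalence = ≋-isEquivalence
            ; ∙-cong        = λ {p} {r} {s} {t} → ⊗-cong p r s t
            }
          ; assoc   = λ p r s → coeffwise (⊗-assoc p r s)
          }
        ; identity = (λ p → coeffwise (⊗-identityˡ p)) , (λ p → coeffwise λ i →
            ≡.trans (⊗-comm p (const 1ℤ) i) (⊗-identityˡ p i))
        }
      ; comm = λ p r → coeffwise (⊗-comm p r)
      }
    ; distribʳ = λ s p r → coeffwise (⊗-distribʳ-⊕ s p r)
    ; zeroˡ    = λ p → ≋-refl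
    }
  }
  where
  ≋-refl : ∀ {p} → p ≋ p
  ≋-refl = coeffwise λ i → ≡.refl

  ≋-isEquivalence : IsEquivalence _≋_
  ≋-isEquivalence = record
    { refl  = ≋-refl
    ; sym   = λ p≋r → coeffwise λ i → ≡.sym (at p≋r i)
    ; trans = λ p≋r r≋s → coeffwise λ i → ≡.trans (at p≋r i) (at r≋s i)
    }

  ⊕-cong : ∀ p r s t → p ≋ r → s ≋ t → p ⊕ s ≋ r ⊕ t
  ⊕-cong p r s t p≋r s≋t = coeffwise λ i → ≡.trans (coeff-⊕ p s i)
    (≡.trans (cong₂ ℤ._+_ (at p≋r i) (at s≋t i)) (≡.sym (coeff-⊕ r t i)))

  ⊕-comm : ∀ p r → p ⊕ r ≋ r ⊕ p
  ⊕-comm p r = coeffwise λ i → ≡.trans (coeff-⊕ p r i)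
    (≡.trans (ℤₚ.+-comm (coeff p i) (coeff r i)) (≡.sym (coeff-⊕ r p i)))

  ⊕-assoc : ∀ p r s → (p ⊕ r) ⊕ s ≋ p ⊕ (r ⊕ s)
  ⊕-assoc p r s = coeffwise assoc
    where
    assoc : (p ⊕ r) ⊕ s ≈ p ⊕ (r ⊕ s)
    assoc i rewrite coeff-⊕ (p ⊕ r) s i | coeff-⊕ p r i | coeff-⊕ p (r ⊕ s) i | coeff-⊕ r s i
      = ℤₚ.+-assoc (coeff p i) (coeff r i) (coeff s i)

  ⊗-cong : ∀ p r s t → p ≋ r → s ≋ t → p ⊗ s ≋ r ⊗ t
  ⊗-cong p r s t p≋r s≋t = coeffwise λ i →
    ≡.trans (⊗-congˡ p s t (at s≋t) i)
      (≡.trans (⊗-comm p t i)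
        (≡.trans (⊗-congˡ t p r (at p≋r) i) (⊗-comm t r i)))

module P = CommutativeSemiring polySemiring
open Exp P.semiring using (^-congˡ) renaming (_^_ to _^ᵖ_)
open SetoidReasoning P.setoid
open SemiringSolver polySemiring using (solve; _:=_; _:+_; _:*_)

-- The indeterminate, q-integers and constants

X : Poly
X = 0ℤ ∷ 1ℤ ∷ []

open DiagonalSum polySemiring using (diag)
open GaussianBinomial polySemiring X

-- Links the objects given as explicit coefficient lists, `q^_` and `[_]q`, to their recursions by
-- multiplication with the indeterminate.
X-⊗ : ∀ p → X ⊗ p ≋ 0ℤ ∷ p
X-⊗ p = coeffwise λ i →
  ≡.trans (0∷-⊗ (const 1ℤ) p i) (∷-cong 0ℤ (const 1ℤ ⊗ p) p (⊗-identityˡ p) i)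

q^≋X^ : ∀ k → q^ k ≋ X ^ᵖ k
q^≋X^ zero    = P.refl
q^≋X^ (suc k) = P.trans (P.sym (X-⊗ (q^ k))) (P.*-congˡ {X} (q^≋X^ k))

[]q≋qInt : ∀ n → [ n ]q ≋ qInt n
[]q≋qInt zero    = P.refl
[]q≋qInt (suc n) = P.+-congˡ {const 1ℤ}
  (P.trans (P.sym (X-⊗ [ n ]q)) (P.*-congˡ {X} ([]q≋qInt n)))

[]q!≋qFact : ∀ n → [ n ]q! ≋ qFact n
[]q!≋qFact zero    = P.refl
[]q!≋qFact (suc n) = P.*-cong ([]q!≋qFact n) ([]q≋qInt (suc n))

const-* : ∀ x y → const (+ (x * y)) ≋ const (+ x) ⊗ const (+ y)
const-* x y = P.reflexive (cong const
  (≡.trans (ℤₚ.pos-* x y) (≡.sym (ℤₚ.+-identityʳ _))))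

const-^ : ∀ x k → const (+ (x ^ k)) ≋ const (+ x) ^ᵖ k
const-^ x zero    = P.refl
const-^ x (suc k) = P.trans (const-* x (x ^ k)) (P.*-congˡ {const (+ x)} (const-^ x k))

-- Fractions equal to polynomials

infix 4 _≐_

-- Comparing fractions only with polynomials avoids the transitivity of _≃_,
-- whose proof would have to cancel denominators.
record _≐_ (x : RatFun) (p : Poly) : Set where
  constructor mk≐
  field
    num≋ : num x ≋ p ⊗ den x

open _≐_

ι-≐ : ∀ {p r} → p ≋ r → ι p ≐ r
ι-≐ p≋r = mk≐ (P.trans p≋r (P.sym (P.*-identityʳ _)))

+ʳ-≐ : ∀ {x y p r} → x ≐ p → y ≐ r → x +ʳ y ≐ p ⊕ r
+ʳ-≐ {x} {y} {p} {r} x≐p y≐r = mk≐ (P.trans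
  (P.+-cong (P.*-congʳ (num≋ x≐p)) (P.*-congʳ (num≋ y≐r)))
  (solve 4 (λ p r c d → p :* c :* d :+ r :* d :* c := (p :+ r) :* (c :* d)) P.refl
    p r (den x) (den y)))

*ʳ-≐ : ∀ {x y p r} → x ≐ p → y ≐ r → x *ʳ y ≐ p ⊗ r
*ʳ-≐ {x} {y} {p} {r} x≐p y≐r = mk≐ (P.trans
  (P.*-cong (num≋ x≐p) (num≋ y≐r))
  (solve 4 (λ p r c d → p :* c :* (r :* d) := p :* r :* (c :* d)) P.refl
    p r (den x) (den y)))

-- Both sums split off the summand with the largest `l`; the index `j` of `g` stands for the
-- difference `h - l`.
Σ≤-≐ : ∀ h {f g} → (∀ l j → l ℕ.+ j ≡ h → f l ≐ g l j) → Σ≤ h f ≐ diag h g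
Σ≤-≐ zero    f≐g = f≐g 0 0 ≡.refl
Σ≤-≐ (suc h) {f} {g} f≐g = +ʳ-≐
  (Σ≤-≐ h {g = λ l j → g l (suc j)}
    λ l j e → f≐g l (suc j) (≡.trans (ℕₚ.+-suc l j) (cong suc e)))
  (f≐g (suc h) 0 (ℕₚ.+-identityʳ (suc h)))

≐⇒≃ : ∀ {p r y} → p ≋ r → y ≐ r → ι p ≃ y
≐⇒≃ {p} {r} {y} p≋r y≐r = at (begin
  p ⊗ den y          ≈⟨ P.*-congʳ p≋r ⟩
  r ⊗ den y          ≈⟨ num≋ y≐r ⟨
  num y              ≈⟨ P.*-identityʳ (num y) ⟨
  num y ⊗ const 1ℤ   ∎)

-- Once `k ≤ k + j` has selected the fraction, the cleared-denominator claim is `qFact-+`.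
qBinom-≐ : ∀ k j → qBinom (k ℕ.+ j) k ≐ gauss k j
qBinom-≐ k j rewrite dec-true (k ℕₚ.≤? k ℕ.+ j) (ℕₚ.m≤m+n k j) = mk≐ (begin
  [ k ℕ.+ j ]q!
    ≈⟨ []q!≋qFact (k ℕ.+ j) ⟩
  qFact (k ℕ.+ j)
    ≈⟨ qFact-+ k j ⟩
  gauss k j ⊗ (qFact k ⊗ qFact j)
    ≈⟨ P.*-congˡ {gauss k j} (P.*-cong ([]q!≋qFact k) ([]q!≋qFact j)) ⟨
  gauss k j ⊗ ([ k ]q! ⊗ [ j ]q!)
    ≡⟨ cong (λ m → gauss k j ⊗ ([ k ]q! ⊗ [ m ]q!)) (ℕₚ.m+n∸m≡n k j) ⟨
  gauss k j ⊗ ([ k ]q! ⊗ [ k ℕ.+ j ∸ k ]q!)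
    ∎)

-- Specialisation to the q-biperiodic Fibonacci sequence

module _ (a b : ℕ) where

  open BiperiodicFibonacci polySemiring X (const (+ a)) (const (+ b))

  -- Abstracting the parity test to `t` lets a known parity reduce the coefficient to `a` or `b`.
  F-step : ∀ m {t} → does (2 ∣? suc (suc m)) ≡ t →
    F a b (suc (suc m)) ≋
      const (+ (if t then a else b)) ⊗ F a b (suc m) ⊕ X ^ᵖ m ⊗ F a b m
  F-step m ≡.refl = P.+-congˡ (P.*-congʳ (q^≋X^ m))

  2∤odd : ∀ h → ¬ 2 ∣ suc (h * 2)
  2∤odd h d with () ← ≡.trans (≡.sym ([m+kn]%n≡m%n 1 h 2)) (n∣m⇒m%n≡0 _ 2 d)

  F-expansion : ∀ N → F a b (suc N) ≋ const (+ a) ^ᵖ (N % 2) ⊗ closed (N % 2) (N / 2)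
  F-expansion N = P.trans
    (P.reflexive (cong (λ m → F a b (suc m)) (m≡m%n+[m/n]*n N 2)))
    (f-expansion (F a b) P.refl P.refl
      (λ h → F-step (h * 2) (dec-true (2 ∣? _) (divides (suc h) ≡.refl)))
      (λ h → F-step (suc (h * 2)) (dec-false (2 ∣? _) (2∤odd (suc h))))
      (N % 2) (N / 2) (m%n<n N 2))

  -- The truncated subtractions are exact, since N = e + 2(l + j) contains `l` twice.
  top : ∀ N l j → l ℕ.+ j ≡ N / 2 → suc N ∸ l ∸ 1 ≡ l ℕ.+ (N % 2 ℕ.+ j * 2)
  top N l j e = ≡R.begin
    suc N ∸ l ∸ 1                             ≡R.≡⟨ ℕₚ.∸-+-assoc (suc N) l 1 ⟩
    suc N ∸ (l ℕ.+ 1)                         ≡R.≡⟨ cong (suc N ∸_) (ℕₚ.+-comm l 1) ⟩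
    N ∸ l                                     ≡R.≡⟨ cong (_∸ l) (m≡m%n+[m/n]*n N 2) ⟩
    N % 2 ℕ.+ N / 2 * 2 ∸ l                   ≡R.≡⟨ cong (λ h → N % 2 ℕ.+ h * 2 ∸ l) e ⟨
    N % 2 ℕ.+ (l ℕ.+ j) * 2 ∸ l               ≡R.≡⟨ cong (_∸ l) (regroup (N % 2) l j) ⟩
    l ℕ.+ (l ℕ.+ (N % 2 ℕ.+ j * 2)) ∸ l       ≡R.≡⟨ ℕₚ.m+n∸m≡n l _ ⟩
    l ℕ.+ (N % 2 ℕ.+ j * 2)                   ≡R.∎
    where
    module ≡R = ≡.≡-Reasoning
    module ℕS = ℕSolver.+-*-Solver
    regroup : ∀ e l j → e ℕ.+ (l ℕ.+ j) * 2 ≡ l ℕ.+ (l ℕ.+ (e ℕ.+ j * 2))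
    regroup = ℕS.solve 3 (λ e l j → e ℕS.:+ (l ℕS.:+ j) ℕS.:* ℕS.con 2
      ℕS.:= l ℕS.:+ (l ℕS.:+ (e ℕS.:+ j ℕS.:* ℕS.con 2))) ≡.refl

  ∣[l+j]-l∣ : ∀ l j → ∣ + (l ℕ.+ j) - + l ∣ ≡ j
  ∣[l+j]-l∣ l j = ≡.trans
    (cong ∣_∣ (≡.trans (ℤₚ.m-n≡m⊖n (l ℕ.+ j) l) (ℤₚ.⊖-≥ (ℕₚ.m≤m+n l j))))
    (ℕₚ.m+n∸m≡n l j)

  term-≐ : ∀ N l j → l ℕ.+ j ≡ N / 2 →
    qBinom (suc N ∸ l ∸ 1) l
      *ʳ ι (const (+ ((a * b) ^ ∣ + (N / 2) - + l ∣)))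
      *ʳ ι (q^ (l ^ 2))
      ≐ term (N % 2) l j
  term-≐ N l j e
    -- Replacing `N / 2` by `l + j` turns the exponent of `a * b` into `j`.
    rewrite top N l j e | ≡.sym e | ∣[l+j]-l∣ l j
    = *ʳ-≐ (*ʳ-≐ (qBinom-≐ l _) (ι-≐ (P.trans (const-^ (a * b) j) (^-congˡ j (const-* a b)))))
           (ι-≐ (q^≋X^ (l ^ 2)))

theorem1 : ∀ (a b : ℕ) .{{_ : NonZero a}} .{{_ : NonZero b}} (n : ℕ) →
    ι (F a b n) ≃
      ι (const (+ (a ^ ξ (+ n - 1ℤ)))) *ʳ
        Σ₀ ⌊ + n - 1ℤ /2⌋ (λ l →
          qBinom (n ∸ l ∸ 1) l
            *ʳ ι (const (+ ((a * b) ^ ∣ ⌊ + n - 1ℤ /2⌋ - + l ∣)))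
            *ʳ ι (q^ (l ^ 2)))
-- Here n - 1 = -1 has floor half -1 and parity 1, so the sum is empty and both sides vanish.
theorem1 a b zero    = ≐⇒≃ (P.sym (P.zeroʳ (const (+ (a ^ 1)))))
  (*ʳ-≐ (ι-≐ {const (+ (a ^ 1))} P.refl) (ι-≐ {[]} P.refl))
-- `+ suc N - 1ℤ` computes to `+ N`, so the floor and the parity are `N / 2` and `N % 2` by
-- definition.
theorem1 a b (suc N) = ≐⇒≃ (F-expansion a b N)
  (*ʳ-≐ (ι-≐ (const-^ a (N % 2))) (Σ≤-≐ (N / 2) (term-≐ a b N)))
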